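{- Let $\mathrm{M}$ be a loopless matroid on a finite set $E$, let $\mathcal{G}=\mathcal{G}_{\max}=\mathcal{L}(\mathrm{M})\setminus\{\hat0\}$ be the maximal building set, and fix any total order $\vartriangleleft$ on $E$. Then the complex $\Gamma_\vartriangleleft(\mathrm{M},\mathcal{G}_{\max})$ is balanced.
   Context: $\mathcal{L}(\mathrm{M})$ is the lattice of flats ordered by inclusion, $\hat0=\varnothing$, $\hat1=E$, $F\vee e=\operatorname{cl}_{\mathrm{M}}(F\cup\{e\})$. For $\mathcal{G}_{\max}$, the maximal nested sets are exactly the sets $\{F_1<F_2<\dots<F_r=E\}$ of nonzero flats forming a maximal chain of $\mathcal{L}(\mathrm{M})\setminus\{\hat0\}$. For such $\mathcal{S}$ and $G\in\mathcal{S}$, let $J^G$ be the element of $\mathcal{S}$ immediately below $G$ (or $\hat0$), $\lambda_{\mathcal{S}}(G)=\min_\vartriangleleft\{e\in E:J^G\vee e=G\}$, and for $G\neq E$ let $p(G)$ be the element of $\mathcal{S}$ immediately above $G$. $G$ is a descent if $G\neq E$ and $\lambda_{\mathcal{S}}(p(G))\vartriangleleft\lambda_{\mathcal{S}}(G)$; a bottom descent if it is a descent and minimal in $\mathcal{S}$; a double descent if it is a descent, not minimal in $\mathcal{S}$, and the element of $\mathcal{S}$ immediately below it is a descent. $\mathrm{Des}(\mathcal{S})$ is the set of descents; a maximal nested set is stable if it has no bottom and no double descent. $C_\vartriangleleft(\hat0,\hat1)=\{\hat0,F_1,\dots,F_n\}$ with $E=\{e_1\vartriangleleft\dots\vartriangleleft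 e_n\}$ and $F_i=\operatorname{cl}_{\mathrm{M}}(\{e_1,\dots,e_i\})$. With $V=\mathcal{G}_{\max}\setminus(C_\vartriangleleft(\hat0,\hat1)\cup\{\text{atoms}\})$, $\Gamma_\vartriangleleft(\mathrm{M},\mathcal{G}_{\max})=\{\mathrm{Des}(\mathcal{S}):\mathcal{S}\text{ stable maximal nested set}\}\subseteq\mathcal{P}(V)$, which is a simplicial complex. A pure simplicial complex of dimension $d$ is balanced if its vertices can be colored with $d+1$ colors so that no face contains two vertices of the same color.
   Formalization: "Balanced" is used without purity: the vertices are coloured with d+1 colours, d the dimension of the complex, no face having two vertices of one colour; purity is neither assumed nor claimed, as it fails, e.g. for the Boolean matroid of rank 5, where {{1,2,5}} is a facet but d=1. -}

module Defs where

open import Data.Fin.Base using (Fin)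
open import Data.Fin.Subset using (Subset; ⊥; ⊤; _∈_; _∉_; _⊆_; _⊂_; _∪_; ⁅_⁆)
open import Data.List.Base using (List; _∷_; length)
open import Data.List.Membership.Propositional using () renaming (_∈_ to _∈ₗ_)
open import Data.List.Relation.Binary.Subset.Propositional using () renaming (_⊆_ to _⊆ₗ_)
open import Data.List.Relation.Unary.Unique.Propositional using (Unique)
open import Data.Nat.Base using (ℕ; _≤_; _<_)
open import Data.Product.Base using (∃-syntax; _×_)
open import Data.Sum.Base using (_⊎_)
open import Function.Bundles using (_⇔_)
open import Level using (0ℓ)
open import Relation.Binary.Core using (Rel)
open import Relation.Binary.PropositionalEquality.Core using (_≡_; _≢_)
open import Relation.Nullary.Negation.Core using (¬_)
open import Relation.Unary using (Pred)

-- A matroid on the ground set Fin n, given by its closure operator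
-- (the last axiom is Mac Lane–Steinitz exchange).
record Matroid (n : ℕ) : Set where
  field
    cl            : Subset n → Subset n
    cl-extensive  : ∀ X → X ⊆ cl X
    cl-monotone   : ∀ {X Y} → X ⊆ Y → cl X ⊆ cl Y
    cl-idempotent : ∀ X → cl (cl X) ≡ cl X
    cl-exchange   : ∀ X x y → y ∈ cl (X ∪ ⁅ x ⁆) → y ∉ cl X → x ∈ cl (X ∪ ⁅ y ⁆)

Loopless : ∀ {n} → Matroid n → Set
Loopless M = ∀ e → e ∉ Matroid.cl M ⊥

-- Finite sets of flats are represented by lists, used only through membership
-- (and through length when duplicate-free).  The bottom flat 0̂ is ⊥ (the empty
-- set) and the top flat 1̂ = E is ⊤.
module _ {n : ℕ} (M : Matroid n) where
  open Matroid M

  IsFlat : Pred (Subset n) 0ℓ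
  IsFlat F = cl F ≡ F

  Gmax : Pred (Subset n) 0ℓ
  Gmax F = IsFlat F × F ≢ ⊥

  IsAtom : Pred (Subset n) 0ℓ
  IsAtom F = Gmax F × (∀ K → Gmax K → ¬ K ⊂ F)

  _∨ᶠ_ : Subset n → Fin n → Subset n
  F ∨ᶠ e = cl (F ∪ ⁅ e ⁆)

  IsChain : Pred (List (Subset n)) 0ℓ
  IsChain S = (∀ F → F ∈ₗ S → Gmax F)
            × (∀ F G → F ∈ₗ S → G ∈ₗ S → F ⊆ G ⊎ G ⊆ F)

  -- For the maximal building set, the maximal nested sets are the maximal
  -- chains of nonzero flats.
  IsMaximalNested : Pred (List (Subset n)) 0ℓ
  IsMaximalNested S = IsChain S × (∀ T → IsChain T → S ⊆ₗ T → T ⊆ₗ S)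

  -- No element of S lies strictly between J and G.
  Immediate : List (Subset n) → Rel (Subset n) 0ℓ
  Immediate S J G = J ⊂ G × (∀ K → K ∈ₗ S → ¬ (J ⊂ K × K ⊂ G))

  IsMinimalIn : List (Subset n) → Pred (Subset n) 0ℓ
  IsMinimalIn S G = G ∈ₗ S × (∀ K → K ∈ₗ S → ¬ K ⊂ G)

  module _ (_◁_ : Rel (Fin n) 0ℓ) where

    IsMin : Pred (Fin n) 0ℓ → Pred (Fin n) 0ℓ
    IsMin P e = P e × (∀ x → P x → e ≡ x ⊎ e ◁ x)

    -- IsLabel S G e says e = λ_S(G); the element J is J^G, which is 0̂ exactly
    -- when G is minimal in S.
    IsLabel : List (Subset n) → Subset n → Pred (Fin n) 0ℓ
    IsLabel S G e =
      ∃[ J ] J ∈ₗ (⊥ ∷ S) × Immediate S J G × IsMin (λ x → J ∨ᶠ x ≡ G) e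

    IsDescent : List (Subset n) → Pred (Subset n) 0ℓ
    IsDescent S G =
        G ∈ₗ S
      × G ≢ ⊤
      × ∃[ p ] p ∈ₗ S × Immediate S G p
        × ∃[ a ] ∃[ b ] IsLabel S p a × IsLabel S G b × a ◁ b

    IsBottomDescent : List (Subset n) → Pred (Subset n) 0ℓ
    IsBottomDescent S G = IsDescent S G × IsMinimalIn S G

    IsDoubleDescent : List (Subset n) → Pred (Subset n) 0ℓ
    IsDoubleDescent S G =
        IsDescent S G
      × ¬ IsMinimalIn S G
      × ∃[ J ] J ∈ₗ S × Immediate S J G × IsDescent S J

    IsStable : Pred (List (Subset n)) 0ℓ
    IsStable S = IsMaximalNested S
               × (∀ G → ¬ IsBottomDescent S G)
               × (∀ G → ¬ IsDoubleDescent S G)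

    -- The set {e₁, …, eᵢ} of the elements up to and including e = eᵢ.
    IsInitialSegment : Fin n → Pred (Subset n) 0ℓ
    IsInitialSegment e I = ∀ x → x ∈ I ⇔ (x ≡ e ⊎ x ◁ e)

    C : Pred (Subset n) 0ℓ
    C F = F ≡ ⊥ ⊎ (∃[ e ] ∃[ I ] IsInitialSegment e I × F ≡ cl I)

    V : Pred (Subset n) 0ℓ
    V F = Gmax F × ¬ C F × ¬ IsAtom F

    -- Γ X says that the finite set X equals Des(S) for some stable S.
    Γ : Pred (List (Subset n)) 0ℓ
    Γ X = Unique X × (∃[ S ] IsStable S × (∀ F → F ∈ₗ X ⇔ IsDescent S F))

-- k = d + 1, where d ≥ -1 is the dimension of Δ, i.e. k is the largest
-- cardinality of a face.  Faces are duplicate-free lists.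
IsDim+1 : {A : Set} → Pred (List A) 0ℓ → Pred ℕ 0ℓ
IsDim+1 Δ k = (∃[ X ] Δ X × length X ≡ k) × (∀ X → Δ X → length X ≤ k)

-- Δ is a complex with vertex set V.  Colours are the naturals below dim Δ + 1;
-- values of colour outside V carry no information.  Purity of Δ is not demanded:
-- Γ need not be pure (for the Boolean matroid on 1 ◁ … ◁ 5 the face {{1,2,5}}
-- is a facet, although there are faces with two elements).
record Balanced {A : Set} (V : Pred A 0ℓ) (Δ : Pred (List A) 0ℓ) : Set where
  field
    dim+1         : ℕ
    isDim+1       : IsDim+1 Δ dim+1
    colour        : A → ℕ
    colour<dim+1  : ∀ v → V v → colour v < dim+1
    colour-proper : ∀ X → Δ X → ∀ v w → v ∈ₗ X → w ∈ₗ X →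
                    colour v ≡ colour w → v ≡ w

{-# OPTIONS --safe #-}
module Submission where

-- Let r be the rank of M.  In a stable chain the bottom flat is not a descent
-- and no two consecutive flats are descents, so the descents have coranks
-- between 1 and r - 2, no two of them adjacent.  Pairing the coranks as {1,2},
-- {3,4}, … therefore gives a proper colouring with k = ⌊(r-1)/2⌋ colours.  That
-- k is attained is seen on the lexicographically first basis B: for every
-- ordering of B, the chain of spans of its prefixes has that ordering as its
-- sequence of labels, and swapping disjoint adjacent pairs of the sorted basis
-- produces k descents.
--
-- The corank of F is the number of e ∈ E not in the closure of F together with
-- the elements below e; exchange makes it strictly antitone on flats, which is
-- all that is needed of a rank function.

open import Data.Fin.Base using (Fin; zero; suc)
open import Data.Fin.Properties using (fromℕ<-injective; injective⇒≤)
open import Data.Fin.Subset using (Subset; ⊥; ⊤; _∈_; _∉_; _⊆_; _⊂_; _∪_; _∩_; ⁅_⁆)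
open import Data.Fin.Subset.Properties
open import Data.List.Base using (List; []; _∷_; length; foldr; drop; applyUpTo; allFin; lookup)
open import Data.List.Membership.Propositional using () renaming (_∈_ to _∈ₗ_)
open import Data.List.Membership.Propositional.Properties using (∈-applyUpTo⁺; ∈-applyUpTo⁻; ∈-allFin; ∈-lookup)
open import Data.List.Properties using (length-applyUpTo; ∷-injectiveˡ; ∷-injectiveʳ)
open import Data.List.Relation.Binary.Permutation.Propositional using (_↭_; ↭-refl; ↭-sym; ↭-swap; ↭⇒↭ₛ)
open import Data.List.Relation.Binary.Permutation.Propositional.Properties using (∈-resp-↭; ↭-length)
import Data.List.Relation.Binary.Permutation.Setoid.Properties as PermutationSetoid
open import Data.List.Relation.Unary.All as All using (All; []; _∷_)
open import Data.List.Relation.Unary.AllPairs as AllPairs using (AllPairs; []; _∷_)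
import Data.List.Relation.Unary.AllPairs.Properties as AllPairs
open import Data.List.Relation.Unary.Any using (here; there)
open import Data.List.Relation.Unary.Linked.Properties using (Linked⇒AllPairs)
open import Data.List.Relation.Unary.Unique.Propositional using (Unique)
open import Data.List.Relation.Unary.Unique.Propositional.Properties using (applyUpTo⁺₁; allFin⁺)
import Data.List.Sort as Sort
open import Data.Nat.Base using (ℕ; zero; suc; pred; _+_; _*_; _≤_; _<_; z≤n; s≤s; z<s; s<s; s≤s⁻¹; ⌊_/2⌋; _≤‴_; ≤‴-refl; ≤‴-step)
open import Data.Nat.Properties
open import Data.Product.Base using (∃-syntax; _×_; _,_; proj₁; proj₂)
open import Data.Sum.Base using (_⊎_; inj₁; inj₂; [_,_]′)
open import Function.Base using (_∘_; id; flip)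
open import Function.Bundles using (mk⇔; Equivalence)
open import Level using (0ℓ)
open import Relation.Binary.Bundles using (DecTotalOrder)
open import Relation.Binary.Core using (Rel)
open import Relation.Binary.Definitions using (tri<; tri≈; tri>)
import Relation.Binary.Construct.Flip.EqAndOrd as Flip
import Relation.Binary.Construct.StrictToNonStrict as StrictToNonStrict
open import Relation.Binary.Structures using (IsStrictTotalOrder)
open import Relation.Binary.PropositionalEquality.Core using (_≡_; _≢_; refl; sym; trans; cong; subst; subst₂)
open import Relation.Binary.PropositionalEquality.Properties using (setoid)
open import Relation.Nullary.Decidable.Core using (yes; no; decidable-stable)
open import Relation.Nullary.Negation.Core using (¬_; contradiction)
open import Defs

-- Arithmetic of increasing sequences and of halving.

-- Climbing from 0 gives `j ≤ f j`; coming down from `r` gives `f j ≤ j`, with `≤‴` providing the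
-- downward induction.
strictlyIncreasing∧end≤⇒id : ∀ {r} (f : ℕ → ℕ) → (∀ j → j < r → f j < f (suc j)) →
                             f r ≤ r → ∀ {j} → j ≤ r → f j ≡ j
strictlyIncreasing∧end≤⇒id {r} f f< fr≤r j≤r =
  ≤-antisym (above (≤⇒≤‴ j≤r)) (below _ j≤r)
  where
  below : ∀ j → j ≤ r → j ≤ f j
  below zero    _   = z≤n
  below (suc j) j<r = ≤-<-trans (below j (<⇒≤ j<r)) (f< j j<r)

  above : ∀ {j} → j ≤‴ r → f j ≤ j
  above ≤‴-refl       = fr≤r
  above (≤‴-step j<r) = s≤s⁻¹ (≤-trans (f< _ (≤‴⇒≤ j<r)) (above j<r))

i<⌊n/2⌋⇒2+i*2≤n : ∀ i n → i < ⌊ n /2⌋ → 2 + i * 2 ≤ n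
i<⌊n/2⌋⇒2+i*2≤n zero    (suc (suc n)) _         = s≤s (s≤s z≤n)
i<⌊n/2⌋⇒2+i*2≤n (suc i) (suc (suc n)) (s<s i<) = s≤s (s≤s (i<⌊n/2⌋⇒2+i*2≤n i n i<))

-- Numbers with equal halves lie in one pair `2i`, `2i + 1`; applied to the shifted coranks of
-- descents of equal colour.
⌊m/2⌋≡⌊n/2⌋⇒m≤1+n : ∀ m n → ⌊ m /2⌋ ≡ ⌊ n /2⌋ → m ≤ suc n
⌊m/2⌋≡⌊n/2⌋⇒m≤1+n zero          _             _  = z≤n
⌊m/2⌋≡⌊n/2⌋⇒m≤1+n (suc zero)    _             _  = s≤s z≤n
⌊m/2⌋≡⌊n/2⌋⇒m≤1+n (suc (suc m)) (suc (suc n)) eq =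
  s≤s (s≤s (⌊m/2⌋≡⌊n/2⌋⇒m≤1+n m n (suc-injective eq)))

i*2≢1+j*2 : ∀ i j → i * 2 ≢ suc (j * 2)
i*2≢1+j*2 (suc i) (suc j) eq = i*2≢1+j*2 i j (suc-injective (suc-injective eq))

-- A gap of two moves to a later pair. Pairs start at 1, hence `pred`; at `m = 0` it would swallow
-- one unit of the gap.
⌊pred[m]/2⌋<⌊pred[n]/2⌋ : ∀ {m n} → 0 < m → 2 + m ≤ n → ⌊ pred m /2⌋ < ⌊ pred n /2⌋
⌊pred[m]/2⌋<⌊pred[n]/2⌋ {suc m} _ (s≤s 2+m≤n) = ⌊n/2⌋-mono 2+m≤n

-- Inclusions of finite subsets.

⊆∧⊄⇒≡ : ∀ {n} {F G : Subset n} → F ⊆ G → ¬ F ⊂ G → F ≡ G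
⊆∧⊄⇒≡ {F = F} F⊆G F⊄G = ⊆-antisym F⊆G λ {x} x∈G →
  decidable-stable (x ∈? F) λ x∉F → F⊄G (F⊆G , x , x∈G , x∉F)

⊆∧≢⇒⊂ : ∀ {n} {F G : Subset n} → F ⊆ G → F ≢ G → F ⊂ G
⊆∧≢⇒⊂ {F = F} {G} F⊆G F≢G = decidable-stable (F ⊂? G) (F≢G ∘ ⊆∧⊄⇒≡ F⊆G)

-- Duplicate-free lists, suffixes and swaps of adjacent pairs.

module _ {A : Set} where

  lookup-injective : ∀ {xs : List A} → Unique xs → ∀ {i j} → lookup xs i ≡ lookup xs j → i ≡ j
  lookup-injective (_ ∷ _)    {zero}  {zero}  _  = refl
  lookup-injective (x∉ ∷ _)   {zero}  {suc j} eq = contradiction eq (All.lookup x∉ (∈-lookup j))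
  lookup-injective (x∉ ∷ _)   {suc i} {zero}  eq = contradiction (sym eq) (All.lookup x∉ (∈-lookup i))
  lookup-injective (_ ∷ uniq) {suc i} {suc j} eq = cong suc (lookup-injective uniq eq)

  -- Pigeonhole: colours map the positions of the list injectively into `Fin k`.
  length≤-by-colouring : ∀ {xs : List A} {k} (f : A → ℕ) → Unique xs →
                         (∀ {x} → x ∈ₗ xs → f x < k) →
                         (∀ {x y} → x ∈ₗ xs → y ∈ₗ xs → f x ≡ f y → x ≡ y) →
                         length xs ≤ k
  length≤-by-colouring f uniq f<k f-inj = injective⇒≤ λ {i} {j} eq →
    lookup-injective uniq (f-inj (∈-lookup i) (∈-lookup j)
      (fromℕ<-injective _ _ (f<k (∈-lookup i)) (f<k (∈-lookup j)) eq))

  ∈-drop⁻ : ∀ j {x} {xs : List A} → x ∈ₗ drop j xs → x ∈ₗ xs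
  ∈-drop⁻ zero                x∈ = x∈
  ∈-drop⁻ (suc j) {xs = _ ∷ _} x∈ = there (∈-drop⁻ j x∈)

  drop-∷ : ∀ j (xs : List A) → j < length xs →
           ∃[ a ] drop j xs ≡ a ∷ drop (suc j) xs
  drop-∷ zero    (x ∷ xs) _        = x , refl
  drop-∷ (suc j) (x ∷ xs) (s<s j<) = drop-∷ j xs j<

  drop-tail : ∀ j {xs t : List A} {a} → drop j xs ≡ a ∷ t → drop (suc j) xs ≡ t
  drop-tail zero                refl = refl
  drop-tail (suc j) {_ ∷ xs} eq   = drop-tail j eq

  drop-length : ∀ (xs : List A) → drop (length xs) xs ≡ []
  drop-length []       = refl
  drop-length (_ ∷ xs) = drop-length xs

  -- The last entry of an odd-length list, and the last two of an even-length
  -- one, stay in place.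
  swapPairs : List A → List A
  swapPairs (x ∷ y ∷ z ∷ l) = y ∷ x ∷ swapPairs (z ∷ l)
  swapPairs l               = l

  swapPairs-↭ : ∀ l → swapPairs l ↭ l
  swapPairs-↭ []              = ↭-refl
  swapPairs-↭ (_ ∷ [])        = ↭-refl
  swapPairs-↭ (_ ∷ _ ∷ [])    = ↭-refl
  swapPairs-↭ (x ∷ y ∷ z ∷ l) = ↭-swap y x (swapPairs-↭ (z ∷ l))

  module _ {_<ₐ_ : Rel A 0ℓ} (asym : ∀ {x y} → x <ₐ y → ¬ y <ₐ x) where

    -- Each swap creates an ascent at an even position. Halving `pred (length l)` counts the swaps,
    -- since a pair is swapped only if something follows it.
    swapPairs-ascent⁺ : ∀ {l} → AllPairs (flip _<ₐ_) l →
                        ∀ i → i < ⌊ pred (length l) /2⌋ →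
                        ∃[ a ] ∃[ b ] ∃[ t ] drop (i * 2) (swapPairs l) ≡ a ∷ b ∷ t × a <ₐ b
    swapPairs-ascent⁺ {x ∷ y ∷ z ∷ l} ((y<x ∷ _) ∷ _) zero    _        = y , x , _ , refl , y<x
    swapPairs-ascent⁺ {x ∷ y ∷ z ∷ l} (_ ∷ _ ∷ desc)  (suc i) (s<s i<) = swapPairs-ascent⁺ desc i i<

    swapPairs-ascent⁻ : ∀ {l} → AllPairs (flip _<ₐ_) l →
                        ∀ j {a b t} → drop j (swapPairs l) ≡ a ∷ b ∷ t → a <ₐ b →
                        ∃[ i ] i < ⌊ pred (length l) /2⌋ × j ≡ i * 2
    swapPairs-ascent⁻ {_ ∷ _ ∷ []} ((b<a ∷ []) ∷ _) zero refl a<b = contradiction a<b (asym b<a)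
    swapPairs-ascent⁻ {x ∷ y ∷ z ∷ l} _ zero _ _ = 0 , z<s , refl
    -- Across the border of two pairs: the swap has put the larger entry `x` second, and everything
    -- behind the pair is smaller than `x`.
    swapPairs-ascent⁻ {x ∷ y ∷ z ∷ l} ((_ ∷ desc) ∷ _) (suc zero) {b = b} {t} eq x<b
      with refl ← ∷-injectiveˡ eq =
      contradiction x<b (asym (All.lookup desc
        (∈-resp-↭ (swapPairs-↭ (z ∷ l)) (subst (b ∈ₗ_) (sym (∷-injectiveʳ eq)) (here refl)))))
    swapPairs-ascent⁻ {x ∷ y ∷ z ∷ l} (_ ∷ _ ∷ desc) (suc (suc j)) eq a<b
      with i , i< , refl ← swapPairs-ascent⁻ desc j eq a<b = suc i , s<s i< , refl
    swapPairs-ascent⁻ {[]}         _ zero                ()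
    swapPairs-ascent⁻ {[]}         _ (suc _)             ()
    swapPairs-ascent⁻ {_ ∷ []}     _ (suc zero)          ()
    swapPairs-ascent⁻ {_ ∷ []}     _ (suc (suc _))       ()
    swapPairs-ascent⁻ {_ ∷ _ ∷ []} _ (suc (suc zero))    ()
    swapPairs-ascent⁻ {_ ∷ _ ∷ []} _ (suc (suc (suc _))) ()

-- Adjoining a list of elements to a subset.

adjoin : ∀ {n} → Subset n → List (Fin n) → Subset n
adjoin = foldr (λ e X → X ∪ ⁅ e ⁆)

module _ {n : ℕ} where

  ∪-⁅⁆⁺ : ∀ {X : Subset n} {x} → x ∈ X ∪ ⁅ x ⁆
  ∪-⁅⁆⁺ {x = x} = x∈p∪q⁺ (inj₂ (x∈⁅x⁆ x))

  ∪-⁅⁆-⊆ : ∀ {X Y : Subset n} {x} → X ⊆ Y → x ∈ Y → X ∪ ⁅ x ⁆ ⊆ Y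
  ∪-⁅⁆-⊆ X⊆Y x∈Y y∈ with x∈p∪q⁻ _ _ y∈
  ... | inj₁ y∈X = X⊆Y y∈X
  ... | inj₂ y∈x with refl ← x∈⁅y⁆⇒x≡y _ y∈x = x∈Y

  ∪-⁅⁆-mono : ∀ {X Y : Subset n} {x} → X ⊆ Y → X ∪ ⁅ x ⁆ ⊆ Y ∪ ⁅ x ⁆
  ∪-⁅⁆-mono X⊆Y = ∪-⁅⁆-⊆ (p⊆p∪q _ ∘ X⊆Y) ∪-⁅⁆⁺

  ⊆-adjoin : ∀ {X : Subset n} l → X ⊆ adjoin X l
  ⊆-adjoin []      = id
  ⊆-adjoin (e ∷ l) = p⊆p∪q _ ∘ ⊆-adjoin l

  adjoin-monoˡ : ∀ {X Y : Subset n} l → X ⊆ Y → adjoin X l ⊆ adjoin Y l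
  adjoin-monoˡ []      X⊆Y = X⊆Y
  adjoin-monoˡ (e ∷ l) X⊆Y = ∪-⁅⁆-mono (adjoin-monoˡ l X⊆Y)

  ∈-adjoin⁺ : ∀ {X : Subset n} {x l} → x ∈ₗ l → x ∈ adjoin X l
  ∈-adjoin⁺ (here refl) = ∪-⁅⁆⁺
  ∈-adjoin⁺ (there x∈l) = p⊆p∪q _ (∈-adjoin⁺ x∈l)

  ∈-adjoin⁻ : ∀ {x : Fin n} l → x ∈ adjoin ⊥ l → x ∈ₗ l
  ∈-adjoin⁻ []      x∈ = contradiction x∈ ∉⊥
  ∈-adjoin⁻ (e ∷ l) x∈ with x∈p∪q⁻ _ _ x∈
  ... | inj₁ x∈l = there (∈-adjoin⁻ l x∈l)
  ... | inj₂ x∈e = here (x∈⁅y⁆⇒x≡y _ x∈e)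

-- Closure and greedy bases.

module MatroidProperties {n : ℕ} (M : Matroid n) where
  open Matroid M

  cl-least : ∀ {X Y} → X ⊆ cl Y → cl X ⊆ cl Y
  cl-least {X} {Y} X⊆clY = subst (cl X ⊆_) (cl-idempotent Y) (cl-monotone X⊆clY)

  cl-absorbs : ∀ {X x} → x ∈ cl X → cl (X ∪ ⁅ x ⁆) ⊆ cl X
  cl-absorbs {X} x∈clX = cl-least (∪-⁅⁆-⊆ (cl-extensive X) x∈clX)

  cl-∪-⁅⁆ : ∀ X x → cl (cl X ∪ ⁅ x ⁆) ≡ cl (X ∪ ⁅ x ⁆)
  cl-∪-⁅⁆ X x = ⊆-antisym
    (cl-least (∪-⁅⁆-⊆ (cl-monotone (p⊆p∪q _)) (cl-extensive _ ∪-⁅⁆⁺)))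
    (cl-monotone (∪-⁅⁆-mono (cl-extensive X)))

  cl-⊤ : cl ⊤ ≡ ⊤
  cl-⊤ = ⊆-antisym ⊆⊤ (cl-extensive ⊤)

  -- The greedy basis of the contraction M / F, reading l from its last entry
  -- to its first.
  greedy : Subset n → List (Fin n) → List (Fin n)
  greedy F []      = []
  greedy F (e ∷ l) with e ∈? cl (adjoin F l)
  ... | yes _ = greedy F l
  ... | no  _ = e ∷ greedy F l

  greedy-⊆ : ∀ F l {x} → x ∈ₗ greedy F l → x ∈ₗ l
  greedy-⊆ F (e ∷ l) x∈ with e ∈? cl (adjoin F l)
  greedy-⊆ F (e ∷ l) x∈          | yes _ = there (greedy-⊆ F l x∈)
  greedy-⊆ F (e ∷ l) (here refl) | no  _ = here refl
  greedy-⊆ F (e ∷ l) (there x∈)  | no  _ = there (greedy-⊆ F l x∈)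

  greedy-∷ : ∀ F e l {x} → x ∈ₗ greedy F l → x ∈ₗ greedy F (e ∷ l)
  greedy-∷ F e l x∈ with e ∈? cl (adjoin F l)
  ... | yes _ = x∈
  ... | no  _ = there x∈

  greedy-AllPairs : ∀ {R : Rel (Fin n) 0ℓ} F {l} → AllPairs R l → AllPairs R (greedy F l)
  greedy-AllPairs F {[]}    _          = []
  greedy-AllPairs F {e ∷ l} (Re ∷ Rl) with e ∈? cl (adjoin F l)
  ... | yes _ = greedy-AllPairs F Rl
  ... | no  _ = All.tabulate (All.lookup Re ∘ greedy-⊆ F l) ∷ greedy-AllPairs F Rl

  -- By monotonicity of closure, an entry that is new over the larger set is new over the smaller
  -- one.
  length-greedy-antitone : ∀ {F G} l → F ⊆ G → length (greedy G l) ≤ length (greedy F l)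
  length-greedy-antitone []      F⊆G = z≤n
  length-greedy-antitone {F} {G} (e ∷ l) F⊆G
    with e ∈? cl (adjoin F l) | e ∈? cl (adjoin G l)
  ... | yes e∈F | no  e∉G = contradiction (cl-monotone (adjoin-monoˡ l F⊆G) e∈F) e∉G
  ... | yes _   | yes _   = length-greedy-antitone l F⊆G
  ... | no  _   | yes _   = m≤n⇒m≤1+n (length-greedy-antitone l F⊆G)
  ... | no  _   | no  _   = s≤s (length-greedy-antitone l F⊆G)

  -- The first e whose adjunction to F captures x is greedy over F, but by
  -- exchange it is not greedy over any set containing x.
  length-greedy-strict : ∀ {F G x} l → F ⊆ G → x ∈ G → x ∉ cl F → x ∈ cl (adjoin F l) →
                         length (greedy G l) < length (greedy F l)
  length-greedy-strict [] F⊆G x∈G x∉clF x∈clF = contradiction x∈clF x∉clF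
  length-greedy-strict {F} {G} {x} (e ∷ l) F⊆G x∈G x∉clF x∈
    with e ∈? cl (adjoin F l) | e ∈? cl (adjoin G l) | x ∈? cl (adjoin F l)
  ... | yes e∈F | no  e∉G | _      = contradiction (cl-monotone (adjoin-monoˡ l F⊆G) e∈F) e∉G
  ... | yes _   | yes _   | yes x∈l = length-greedy-strict l F⊆G x∈G x∉clF x∈l
  ... | no  _   | yes _   | yes x∈l = m<n⇒m<1+n (length-greedy-strict l F⊆G x∈G x∉clF x∈l)
  ... | no  _   | no  _   | yes x∈l = s<s (length-greedy-strict l F⊆G x∈G x∉clF x∈l)
  ... | yes e∈F | _       | no x∉l = contradiction (cl-absorbs e∈F x∈) x∉l
  ... | no  _   | yes _   | no _   = s≤s (length-greedy-antitone l F⊆G)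
  ... | no  _   | no  e∉G | no x∉l = contradiction
    (cl-monotone (∪-⁅⁆-⊆ (adjoin-monoˡ l F⊆G) (⊆-adjoin l x∈G)) (cl-exchange _ e x x∈ x∉l)) e∉G

  length-greedy-⊤ : ∀ l → length (greedy ⊤ l) ≡ 0
  length-greedy-⊤ []      = refl
  length-greedy-⊤ (e ∷ l) with e ∈? cl (adjoin ⊤ l)
  ... | yes _  = length-greedy-⊤ l
  ... | no  e∉ = contradiction (cl-extensive _ (⊆-adjoin l ∈⊤)) e∉

  greedy-spans : ∀ l {x} → x ∈ₗ l → x ∈ cl (adjoin ⊥ (greedy ⊥ l))
  greedy-spans (e ∷ l) x∈ with e ∈? cl (adjoin ⊥ l)
  greedy-spans (e ∷ l) (here refl) | yes e∈l = cl-least (greedy-spans l ∘ ∈-adjoin⁻ l) e∈l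
  greedy-spans (e ∷ l) (there x∈)  | yes _   = greedy-spans l x∈
  greedy-spans (e ∷ l) (here refl) | no  _   = cl-extensive _ ∪-⁅⁆⁺
  greedy-spans (e ∷ l) (there x∈)  | no  _   = cl-monotone (p⊆p∪q _) (greedy-spans l x∈)

  -- If `a` is the entry read last, `T` lies among the entries read before it, whose closure misses
  -- `a`. Otherwise exchange turns a dependence of `a` on `T` into one of the last-read entry `e` on
  -- earlier ones.
  greedy-independent : ∀ l {a} → a ∈ₗ greedy ⊥ l → ∀ T →
                       (∀ {y} → y ∈ T → y ∈ₗ greedy ⊥ l × y ≢ a) → a ∉ cl T
  greedy-independent (e ∷ l) {a} a∈ T T⊆ a∈clT with e ∈? cl (adjoin ⊥ l)
  ... | yes _   = greedy-independent l a∈ T T⊆ a∈clT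
  ... | no  e∉l with a∈
  ... | here refl = e∉l (cl-monotone T⊆l a∈clT)
    where
    T⊆l : T ⊆ adjoin ⊥ l
    T⊆l y∈T with T⊆ y∈T
    ... | here refl , y≢e = contradiction refl y≢e
    ... | there y∈  , _   = ∈-adjoin⁺ (greedy-⊆ ⊥ l y∈)
  ... | there a∈l = e∉l (cl-monotone T′∪a⊆l
        (cl-exchange T′ e a (cl-monotone T⊆T′∪e a∈clT)
          (greedy-independent l a∈l T′ λ y∈T′ →
            let y∈T , y∈l = x∈p∩q⁻ _ _ y∈T′ in ∈-adjoin⁻ (greedy ⊥ l) y∈l , proj₂ (T⊆ y∈T))))
    where
    -- This is `T` without `e`.
    T′ = T ∩ adjoin ⊥ (greedy ⊥ l)

    T⊆T′∪e : T ⊆ T′ ∪ ⁅ e ⁆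
    T⊆T′∪e y∈T with T⊆ y∈T
    ... | here refl , _ = ∪-⁅⁆⁺
    ... | there y∈  , _ = p⊆p∪q _ (x∈p∩q⁺ (y∈T , ∈-adjoin⁺ y∈))

    T′∪a⊆l : T′ ∪ ⁅ a ⁆ ⊆ adjoin ⊥ l
    T′∪a⊆l = ∪-⁅⁆-⊆
      (λ y∈T′ → ∈-adjoin⁺ (greedy-⊆ ⊥ l (∈-adjoin⁻ (greedy ⊥ l) (proj₂ (x∈p∩q⁻ _ _ y∈T′)))))
      (∈-adjoin⁺ (greedy-⊆ ⊥ l a∈l))

-- The sorted ground set and the corank of a flat.

module DescentComplex {n : ℕ} (M : Matroid n) (loopless : Loopless M)
                      (_◁_ : Rel (Fin n) 0ℓ) (◁-sto : IsStrictTotalOrder _≡_ _◁_) where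
  open Matroid M
  open MatroidProperties M
  private module ◁ = IsStrictTotalOrder ◁-sto

  -- Reversed, so that sorting puts the smallest element last, where `greedy` starts reading.
  ▷-decTotalOrder : DecTotalOrder 0ℓ 0ℓ 0ℓ
  ▷-decTotalOrder = record
    { isDecTotalOrder = StrictToNonStrict.isDecTotalOrder _≡_ (flip _◁_) (Flip.isStrictTotalOrder ◁-sto) }

  open Sort ▷-decTotalOrder using (sort; sort-↭; sort-↗)

  elements : List (Fin n)
  elements = sort (allFin n)

  ∈-elements : ∀ x → x ∈ₗ elements
  ∈-elements x = ∈-resp-↭ (↭-sym (sort-↭ _)) (∈-allFin x)

  Unique-resp-↭ : ∀ {xs ys : List (Fin n)} → xs ↭ ys → Unique xs → Unique ys
  Unique-resp-↭ p = PermutationSetoid.Unique-resp-↭ (setoid (Fin n)) (↭⇒↭ₛ p)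

  elements-descending : AllPairs (flip _◁_) elements
  elements-descending = AllPairs.zipWith
    (λ { (inj₁ y◁x , _) → y◁x ; (inj₂ x≡y , x≢y) → contradiction x≡y x≢y })
    ( Linked⇒AllPairs (DecTotalOrder.trans ▷-decTotalOrder) (sort-↗ (allFin n))
    , Unique-resp-↭ (↭-sym (sort-↭ _)) (allFin⁺ n))

  -- The greedy basis of M / F has r(M) - r(F) elements.
  corank : Subset n → ℕ
  corank F = length (greedy F elements)

  corank-strict : ∀ {F G} → IsFlat M F → F ⊂ G → corank G < corank F
  corank-strict {F} clF≡F (F⊆G , x , x∈G , x∉F) =
    length-greedy-strict elements F⊆G x∈G (x∉F ∘ subst (x ∈_) clF≡F)
      (cl-extensive _ (∈-adjoin⁺ (∈-elements x)))

  corank-⊤ : corank ⊤ ≡ 0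
  corank-⊤ = length-greedy-⊤ elements

  r : ℕ
  r = corank ⊥

  ⊥-flat : IsFlat M ⊥
  ⊥-flat = ⊆-antisym (λ {x} x∈ → contradiction x∈ (loopless x)) ⊥⊆

  corank-Gmax : ∀ {F} → Gmax M F → corank F < r
  corank-Gmax (_ , F≢⊥) = corank-strict ⊥-flat (⊆∧≢⇒⊂ ⊥⊆ (F≢⊥ ∘ sym))

  0<corank : ∀ {F} → IsFlat M F → F ≢ ⊤ → 0 < corank F
  0<corank {F} flat F≢⊤ = subst (_< corank F) corank-⊤ (corank-strict flat (⊆∧≢⇒⊂ ⊆⊤ F≢⊤))

  -- A nonzero flat `K` strictly inside `F` gives two strict drops of corank from `⊥` to `F`. As the
  -- hypothesis does not exhibit `K`, the inequality is reached by double negation.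
  2+corank≤r : ∀ {F} → ¬ (∀ K → Gmax M K → ¬ K ⊂ F) → 2 + corank F ≤ r
  2+corank≤r {F} ¬low = decidable-stable (2 + corank F ≤? r) λ ≰r → ¬low λ K K∈ K⊂F →
    ≰r (≤-trans (s≤s (corank-strict (proj₁ K∈) K⊂F)) (corank-Gmax K∈))

  comparable∧corank≡⇒≡ : ∀ {F G} → IsFlat M F → IsFlat M G → F ⊆ G ⊎ G ⊆ F →
                         corank F ≡ corank G → F ≡ G
  comparable∧corank≡⇒≡ flatF flatG (inj₁ F⊆G) eq =
    ⊆∧⊄⇒≡ F⊆G λ F⊂G → <⇒≢ (corank-strict flatF F⊂G) (sym eq)
  comparable∧corank≡⇒≡ flatF flatG (inj₂ G⊆F) eq =
    sym (comparable∧corank≡⇒≡ flatG flatF (inj₁ G⊆F) (sym eq))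

  -- A flat strictly between would have a corank strictly between two coranks that differ by at most
  -- one.
  corank-step⇒immediate : ∀ {S J G} → IsChain M S → IsFlat M J → J ⊂ G →
                          corank J ≤ suc (corank G) → Immediate M S J G
  corank-step⇒immediate (S⊆Gmax , _) flatJ J⊂G J≤1+G = J⊂G , λ K K∈S (J⊂K , K⊂G) →
    <-irrefl refl (≤-trans (s≤s (corank-strict (proj₁ (S⊆Gmax K K∈S)) K⊂G))
                           (≤-trans (corank-strict flatJ J⊂K) J≤1+G))

  -- The colouring, its range and its properness on descents.

  k : ℕ
  k = ⌊ pred r /2⌋

  colour : Subset n → ℕ
  colour F = ⌊ pred (corank F) /2⌋

  -- The largest element has all of the ground set as its initial segment; on an empty ground set
  -- `⊤` is `⊥`. Hence `⊤` is no vertex, and vertices have positive corank.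
  ⊤∈C : C M _◁_ ⊤
  ⊤∈C with elements | ∈-elements | elements-descending
  ... | []    | ∈[] | _ = inj₁ (⊆-antisym (λ {x} _ → contradiction (∈[] x) λ ()) ⊥⊆)
  ... | e ∷ l | ∈el | l◁e ∷ _ = inj₂ (e , ⊤ , (λ x → mk⇔ (λ _ → below (∈el x)) (λ _ → ∈⊤)) , sym cl-⊤)
    where
    below : ∀ {x} → x ∈ₗ e ∷ l → x ≡ e ⊎ x ◁ e
    below (here x≡e)  = inj₁ x≡e
    below (there x∈l) = inj₂ (All.lookup l◁e x∈l)

  colour<k : ∀ F → V M _◁_ F → colour F < k
  colour<k F (F∈ , F∉C , ¬atom) = ⌊pred[m]/2⌋<⌊pred[n]/2⌋
    (0<corank (proj₁ F∈) λ { refl → F∉C ⊤∈C })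
    (2+corank≤r λ min → ¬atom (F∈ , min))

  module _ {S : List (Subset n)} (stable : IsStable M _◁_ S) where
    private
      chain   = proj₁ (proj₁ stable)
      S⊆Gmax  = proj₁ chain

    0<corank-descent : ∀ {F} → IsDescent M _◁_ S F → 0 < corank F
    0<corank-descent (F∈S , F≢⊤ , _) = 0<corank (proj₁ (S⊆Gmax _ F∈S)) F≢⊤

    -- If no nonzero flat lay strictly inside `F`, then `F` would be minimal in `S`, a bottom
    -- descent.
    colour-descent<k : ∀ {F} → IsDescent M _◁_ S F → colour F < k
    colour-descent<k {F} des@(F∈S , _) = ⌊pred[m]/2⌋<⌊pred[n]/2⌋ (0<corank-descent des)
      (2+corank≤r λ low → proj₁ (proj₂ stable) F (des , F∈S , λ K K∈S → low K (S⊆Gmax K K∈S)))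

    -- Two nested descents of the same colour would be consecutive in S.
    ¬⊂-descents : ∀ {F G} → IsDescent M _◁_ S F → IsDescent M _◁_ S G →
                  colour F ≡ colour G → ¬ F ⊂ G
    ¬⊂-descents {F} {G} desF@(F∈S , _) desG eq F⊂G = proj₂ (proj₂ stable) G
      ( desG
      , (λ (_ , min) → min F F∈S F⊂G)
      , F , F∈S , corank-step⇒immediate chain (proj₁ (S⊆Gmax F F∈S)) F⊂G F≤1+G , desF)
      where
      F≤1+G : corank F ≤ suc (corank G)
      F≤1+G with corank F | corank G | 0<corank-descent desF | 0<corank-descent desG
               | ⌊m/2⌋≡⌊n/2⌋⇒m≤1+n _ _ eq
      ... | suc _ | suc _ | _ | _ | ≤ = s≤s ≤

    colour-injective : ∀ {F G} → IsDescent M _◁_ S F → IsDescent M _◁_ S G →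
                       colour F ≡ colour G → F ≡ G
    colour-injective {F} {G} desF desG eq with proj₂ chain F G (proj₁ desF) (proj₁ desG)
    ... | inj₁ F⊆G = ⊆∧⊄⇒≡ F⊆G (¬⊂-descents desF desG eq)
    ... | inj₂ G⊆F = sym (⊆∧⊄⇒≡ G⊆F (¬⊂-descents desG desF (sym eq)))

  -- The lexicographically first basis and the flag of its rearrangement.

  -- The suffix of `l` starting at `x` has `x` as its largest entry, and its greedy basis spans it
  -- and survives in that of `l`. This is the minimality that makes the basis lexicographically
  -- first.
  greedy-spans-below : ∀ {l} → AllPairs (flip _◁_) l → ∀ {x} → x ∈ₗ l →
                       ∃[ T ] x ∈ cl T × (∀ {y} → y ∈ T → y ∈ₗ greedy ⊥ l × (y ≡ x ⊎ y ◁ x))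
  greedy-spans-below {e ∷ l} (l◁e ∷ _) (here refl) =
    adjoin ⊥ (greedy ⊥ (e ∷ l)) , greedy-spans (e ∷ l) (here refl) ,
    λ y∈ → let y∈B = ∈-adjoin⁻ (greedy ⊥ (e ∷ l)) y∈ in y∈B , below (greedy-⊆ ⊥ (e ∷ l) y∈B)
    where
    below : ∀ {y} → y ∈ₗ e ∷ l → y ≡ e ⊎ y ◁ e
    below (here y≡e)  = inj₁ y≡e
    below (there y∈l) = inj₂ (All.lookup l◁e y∈l)
  greedy-spans-below {e ∷ l} (_ ∷ desc) (there x∈) =
    let T , x∈clT , T⊆ = greedy-spans-below desc x∈
    in T , x∈clT , λ y∈T → let y∈B , y≤x = T⊆ y∈T in greedy-∷ ⊥ e l y∈B , y≤x

  -- Read from the top: the j-th entry of word is the label of the flat of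
  -- corank j in the chain it spans.
  basis word : List (Fin n)
  basis = greedy ⊥ elements
  word  = swapPairs basis

  word-↭ : word ↭ basis
  word-↭ = swapPairs-↭ basis

  basis-descending : AllPairs (flip _◁_) basis
  basis-descending = greedy-AllPairs ⊥ elements-descending

  word-unique : Unique word
  word-unique = Unique-resp-↭ (↭-sym word-↭)
    (AllPairs.map (λ y◁x x≡y → ◁.irrefl (sym x≡y) y◁x) basis-descending)

  span : List (Fin n) → Subset n
  span l = cl (adjoin ⊥ l)

  -- Indexed from the top, so that `j` is the corank.
  flag : ℕ → Subset n
  flag j = span (drop j word)

  flag-flat : ∀ j → IsFlat M (flag j)
  flag-flat j = cl-idempotent _

  flag-0 : flag 0 ≡ ⊤
  flag-0 = ⊆-antisym ⊆⊤ λ {x} _ →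
    cl-least (cl-extensive _ ∘ ∈-adjoin⁺ ∘ ∈-resp-↭ (↭-sym word-↭) ∘ ∈-adjoin⁻ basis)
      (greedy-spans elements (∈-elements x))

  flag-r : flag r ≡ ⊥
  flag-r = trans (cong span (trans (cong (λ j → drop j word) (sym (↭-length word-↭))) (drop-length word)))
                 ⊥-flat

  module _ j {a t} (eq : drop j word ≡ a ∷ t) where
    private
      ∈basis : ∀ {x} → x ∈ₗ a ∷ t → x ∈ₗ basis
      ∈basis x∈ = ∈-resp-↭ word-↭ (∈-drop⁻ j (subst (_ ∈ₗ_) (sym eq) x∈))

      t≢a : ∀ {x} → x ∈ₗ t → x ≢ a
      t≢a x∈t with a∉t ∷ _ ← subst Unique eq (AllPairs.drop⁺ j word-unique) =
        All.lookup a∉t x∈t ∘ sym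

    head∉span : a ∉ span t
    head∉span = greedy-independent elements (∈basis (here refl)) (adjoin ⊥ t) λ y∈ →
      let y∈t = ∈-adjoin⁻ t y∈ in ∈basis (there y∈t) , t≢a y∈t

    -- A smaller x would lie in the span of the basis elements up to x, and
    -- exchanging it with a would put a in the span of other basis elements.
    head-least : ∀ {x} → x ∈ span (a ∷ t) → x ∉ span t → a ≡ x ⊎ a ◁ x
    head-least {x} x∈ x∉ with ◁.compare a x
    ... | tri< a◁x _ _ = inj₂ a◁x
    ... | tri≈ _ a≡x _ = inj₁ a≡x
    ... | tri> _ _ x◁a =
      let T , x∈clT , T⊆ = greedy-spans-below elements-descending (∈-elements x)
      in contradiction
        (cl-least (∪-⁅⁆-⊆ (cl-extensive _ ∘ q⊆p∪q T _) (cl-monotone (p⊆p∪q _) x∈clT))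
          (cl-exchange _ a x x∈ x∉))
        (greedy-independent elements (∈basis (here refl)) (T ∪ adjoin ⊥ t) λ y∈ →
          [ (λ y∈T → let y∈B , y≤x = T⊆ y∈T in y∈B , λ { refl →
              [ (λ { refl → ◁.irrefl refl x◁a }) , ◁.asym x◁a ]′ y≤x })
          , (λ y∈ → let y∈t = ∈-adjoin⁻ t y∈ in ∈basis (there y∈t) , t≢a y∈t)
          ]′ (x∈p∪q⁻ _ _ y∈))

  word-∷ : ∀ {j} → j < r → ∃[ a ] drop j word ≡ a ∷ drop (suc j) word
  word-∷ j<r = drop-∷ _ word (subst (_ <_) (sym (↭-length word-↭)) j<r)

  flag-step : ∀ {j} → j < r → flag (suc j) ⊂ flag j
  flag-step {j} j<r with a , eq ← word-∷ j<r =
    subst (flag (suc j) ⊂_) (cong span (sym eq))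
      (cl-monotone (p⊆p∪q _) , a , cl-extensive _ ∪-⁅⁆⁺ , head∉span j eq)

  -- Coranks rise strictly in each of the `r` steps down to `flag r`, whose corank is `r`, so every
  -- value is forced.
  corank-flag : ∀ {j} → j ≤ r → corank (flag j) ≡ j
  corank-flag = strictlyIncreasing∧end≤⇒id (corank ∘ flag)
    (λ j j<r → corank-strict (flag-flat (suc j)) (flag-step j<r))
    (≤-reflexive (cong corank flag-r))

  flag-antitone : ∀ {i j} → i ≤‴ j → j ≤ r → flag j ⊆ flag i
  flag-antitone ≤‴-refl       _   = id
  flag-antitone (≤‴-step i<j) j≤r =
    proj₁ (flag-step (≤-trans (≤‴⇒≤ i<j) j≤r)) ∘ flag-antitone i<j j≤r

  flag-strict : ∀ {i j} → i < j → j ≤ r → flag j ⊂ flag i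
  flag-strict i<j j≤r = ⊆-⊂-trans (flag-antitone (≤⇒≤‴ i<j) j≤r) (flag-step (≤-trans i<j j≤r))

  flag-⊂⁻ : ∀ {i j} → i ≤ r → j ≤ r → flag j ⊂ flag i → i < j
  flag-⊂⁻ {j = j} i≤r j≤r sub = subst₂ _<_ (corank-flag i≤r) (corank-flag j≤r) (corank-strict (flag-flat j) sub)

  flag-injective : ∀ {i j} → i ≤ r → j ≤ r → flag i ≡ flag j → i ≡ j
  flag-injective i≤r j≤r eq = trans (sym (corank-flag i≤r)) (trans (cong corank eq) (corank-flag j≤r))

  flags : List (Subset n)
  flags = applyUpTo flag r

  flags-chain : IsChain M flags
  flags-chain = gmax , comparable
    where
    gmax : ∀ F → F ∈ₗ flags → Gmax M F
    gmax F F∈ with j , j<r , refl ← ∈-applyUpTo⁻ flag F∈ =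
      flag-flat j , λ eq → <⇒≢ j<r (flag-injective (<⇒≤ j<r) ≤-refl (trans eq (sym flag-r)))

    comparable : ∀ F G → F ∈ₗ flags → G ∈ₗ flags → F ⊆ G ⊎ G ⊆ F
    comparable F G F∈ G∈
      with i , i<r , refl ← ∈-applyUpTo⁻ flag F∈ | j , j<r , refl ← ∈-applyUpTo⁻ flag G∈
      with ≤-total i j
    ... | inj₁ i≤j = inj₂ (flag-antitone (≤⇒≤‴ i≤j) (<⇒≤ j<r))
    ... | inj₂ j≤i = inj₁ (flag-antitone (≤⇒≤‴ j≤i) (<⇒≤ i<r))

  -- A flat of a larger chain is comparable with the flat of the flag that has the same corank,
  -- hence equal to it.
  flags-maximal : IsMaximalNested M flags
  flags-maximal = flags-chain , λ T (T⊆Gmax , comparable) S⊆T {F} F∈T →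
    let F∈Gmax = T⊆Gmax F F∈T
        j<r    = corank-Gmax F∈Gmax
        G∈S    = ∈-applyUpTo⁺ flag j<r
    in subst (_∈ₗ flags)
         (sym (comparable∧corank≡⇒≡ (proj₁ F∈Gmax) (flag-flat (corank F))
           (comparable F _ F∈T (S⊆T G∈S)) (sym (corank-flag (<⇒≤ j<r)))))
         G∈S

  flag-immediate : ∀ {j} → j < r → Immediate M flags (flag (suc j)) (flag j)
  flag-immediate {j} j<r = corank-step⇒immediate flags-chain (flag-flat (suc j)) (flag-step j<r)
    (≤-reflexive (trans (corank-flag j<r) (cong suc (sym (corank-flag (<⇒≤ j<r))))))

  flag-immediate⁻ : ∀ {i j} → i ≤ r → j ≤ r → Immediate M flags (flag i) (flag j) → i ≡ suc j
  flag-immediate⁻ {i} {j} i≤r j≤r (i⊂j , gap) with <-cmp (suc j) i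
  ... | tri≈ _ eq _ = sym eq
  ... | tri> _ _ i<1+j = contradiction (flag-⊂⁻ j≤r i≤r i⊂j) (<⇒≱ i<1+j)
  -- Here `flag (suc j)` would lie strictly in between.
  ... | tri< 1+j<i _ _ = contradiction
    (flag-strict 1+j<i i≤r , flag-step (<-trans (n<1+n j) (≤-trans 1+j<i i≤r)))
    (gap _ (∈-applyUpTo⁺ flag (≤-trans 1+j<i i≤r)))

  -- Labels along the flag.

  ∈-⊥∷flags⁻ : ∀ {J} → J ∈ₗ ⊥ ∷ flags → ∃[ i ] i ≤ r × J ≡ flag i
  ∈-⊥∷flags⁻ (here refl) = r , ≤-refl , sym flag-r
  ∈-⊥∷flags⁻ (there J∈) = let i , i<r , eq = ∈-applyUpTo⁻ flag J∈ in i , <⇒≤ i<r , eq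

  ∈-⊥∷flags⁺ : ∀ {i} → i ≤ r → flag i ∈ₗ ⊥ ∷ flags
  ∈-⊥∷flags⁺ i≤r with m≤n⇒m<n∨m≡n i≤r
  ... | inj₁ i<r  = there (∈-applyUpTo⁺ flag i<r)
  ... | inj₂ refl = here flag-r

  label-flag : ∀ {j a t} → j < r → drop j word ≡ a ∷ t → IsLabel M _◁_ flags (flag j) a
  label-flag {j} {a} {t} j<r eq =
    flag (suc j) , ∈-⊥∷flags⁺ j<r , flag-immediate j<r ,
    trans (cl-∪-⁅⁆ _ a) (sym flag-j) ,
    λ x join≡ → head-least j eq
      (subst (x ∈_) (trans join≡ (cong span eq)) (cl-extensive _ ∪-⁅⁆⁺))
      -- Joining an element of `flag (suc j)` to it stays inside it, strictly below `flag j`.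
      λ x∈t → ⊂-irref join≡ (⊆-⊂-trans
        (subst (cl (flag (suc j) ∪ ⁅ x ⁆) ⊆_) (flag-flat (suc j)) (cl-monotone (∪-⁅⁆-⊆ id (subst (x ∈_) (cong span (sym tail)) x∈t))))
        (flag-step j<r))
    where
    tail : drop (suc j) word ≡ t
    tail = drop-tail j eq

    flag-j : flag j ≡ cl (adjoin ⊥ (drop (suc j) word) ∪ ⁅ a ⁆)
    flag-j = cong span (trans eq (cong (a ∷_) (sym tail)))

  -- The flat below is determined as `flag (suc j)`, and two minima over the same set agree by
  -- asymmetry.
  label-unique : ∀ {j a b} → j < r → IsLabel M _◁_ flags (flag j) a →
                 IsLabel M _◁_ flags (flag j) b → a ≡ b
  label-unique j<r (J , J∈ , J⋖ , a∈ , a-min) (K , K∈ , K⋖ , b∈ , b-min)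
    with i , i≤r , refl ← ∈-⊥∷flags⁻ J∈ | i′ , i′≤r , refl ← ∈-⊥∷flags⁻ K∈
    with refl ← flag-immediate⁻ i≤r (<⇒≤ j<r) J⋖ | refl ← flag-immediate⁻ i′≤r (<⇒≤ j<r) K⋖
    with a-min _ b∈ | b-min _ a∈
  ... | inj₁ a≡b | _        = a≡b
  ... | inj₂ _   | inj₁ b≡a = sym b≡a
  ... | inj₂ a◁b | inj₂ b◁a = contradiction b◁a (◁.asym a◁b)

  -- Descents of the flag.

  2+i*2<r : ∀ {i} → i < k → 2 + i * 2 < r
  2+i*2<r {i} i<k with r | i<⌊n/2⌋⇒2+i*2≤n i _ i<k
  ... | suc _ | ≤r = s≤s ≤r

  1+i*2<r : ∀ {i} → i < k → 1 + i * 2 < r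
  1+i*2<r i<k = <-trans (n<1+n _) (2+i*2<r i<k)

  -- The ascent of `word` at position `i * 2` compares the labels of `flag (i * 2)` and of the flat
  -- just below it. The lower flat is the descent, hence the odd index.
  flag-descent⁺ : ∀ {i} → i < k → IsDescent M _◁_ flags (flag (suc (i * 2)))
  flag-descent⁺ {i} i<k =
    let a , b , t , eq , a◁b = swapPairs-ascent⁺ ◁.asym basis-descending i i<k
    in ∈-applyUpTo⁺ flag 1+<r
     , (λ ≡⊤ → 1+n≢0 (flag-injective (<⇒≤ 1+<r) z≤n (trans ≡⊤ (sym flag-0))))
     , flag (i * 2) , ∈-applyUpTo⁺ flag i*2<r , flag-immediate i*2<r
     , a , b , label-flag i*2<r eq , label-flag 1+<r (drop-tail (i * 2) eq) , a◁b
    where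
    1+<r  = 1+i*2<r i<k
    i*2<r = <-trans (n<1+n _) 1+<r

  -- Labels being unique, a descent comes from an ascent between consecutive entries of `word`, and
  -- only swaps create those.
  flag-descent⁻ : ∀ {F} → IsDescent M _◁_ flags F → ∃[ i ] i < k × F ≡ flag (suc (i * 2))
  flag-descent⁻ (F∈ , _ , p , p∈ , F⋖p , a , b , a-label , b-label , a◁b)
    with i , i<r , refl ← ∈-applyUpTo⁻ flag F∈ | j , j<r , refl ← ∈-applyUpTo⁻ flag p∈
    with refl ← flag-immediate⁻ (<⇒≤ i<r) (<⇒≤ j<r) F⋖p
    with a′ , eq ← word-∷ j<r | b′ , eq′ ← word-∷ i<r
    with refl ← label-unique j<r (label-flag j<r eq) a-label
       | refl ← label-unique i<r (label-flag i<r eq′) b-label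
    with m , m<k , refl ← swapPairs-ascent⁻ ◁.asym basis-descending j (trans eq (cong (a ∷_) eq′)) a◁b
    = m , m<k , refl

  -- Below a descent `flag (1 + i * 2)` the chain still contains `flag (2 + i * 2)`, so it is not
  -- minimal; parity of the indices excludes consecutive descents.
  flags-stable : IsStable M _◁_ flags
  flags-stable = flags-maximal , noBottom , noDouble
    where
    noBottom : ∀ G → ¬ IsBottomDescent M _◁_ flags G
    noBottom G (des , _ , min) with i , i<k , refl ← flag-descent⁻ des =
      min _ (∈-applyUpTo⁺ flag (2+i*2<r i<k)) (flag-step (1+i*2<r i<k))

    noDouble : ∀ G → ¬ IsDoubleDescent M _◁_ flags G
    noDouble G (desG , _ , J , _ , J⋖G , desJ)
      with i , i<k , refl ← flag-descent⁻ desG | j , j<k , refl ← flag-descent⁻ desJ =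
      i*2≢1+j*2 j i (suc-injective (flag-immediate⁻ (<⇒≤ (1+i*2<r j<k)) (<⇒≤ (1+i*2<r i<k)) J⋖G))

  -- The face with `k` elements, which attains the dimension.
  oddFlags : List (Subset n)
  oddFlags = applyUpTo (λ i → flag (suc (i * 2))) k

  oddFlags∈Γ : Γ M _◁_ oddFlags
  oddFlags∈Γ = applyUpTo⁺₁ _ k distinct , flags , flags-stable , λ F → mk⇔ to from
    where
    distinct : ∀ {i j} → i < j → j < k → flag (suc (i * 2)) ≢ flag (suc (j * 2))
    distinct {i} {j} i<j j<k eq = <⇒≢ i<j (*-cancelʳ-≡ i j 2
      (suc-injective (flag-injective (<⇒≤ (1+i*2<r (<-trans i<j j<k))) (<⇒≤ (1+i*2<r j<k)) eq)))

    to : ∀ {F} → F ∈ₗ oddFlags → IsDescent M _◁_ flags F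
    to F∈ with i , i<k , refl ← ∈-applyUpTo⁻ _ F∈ = flag-descent⁺ i<k

    from : ∀ {F} → IsDescent M _◁_ flags F → F ∈ₗ oddFlags
    from des with i , i<k , refl ← flag-descent⁻ des = ∈-applyUpTo⁺ _ i<k

  -- Balancedness.

  Γ-colour-injective : ∀ X → Γ M _◁_ X → ∀ F G → F ∈ₗ X → G ∈ₗ X → colour F ≡ colour G → F ≡ G
  Γ-colour-injective X (_ , S , stable , X⇔Des) F G F∈X G∈X =
    colour-injective stable (Equivalence.to (X⇔Des F) F∈X) (Equivalence.to (X⇔Des G) G∈X)

  -- Colours are distinct on a face and, by stability, less than `k`.
  Γ-length≤k : ∀ X → Γ M _◁_ X → length X ≤ k
  Γ-length≤k X X∈Γ@(uniq , S , stable , X⇔Des) = length≤-by-colouring colour uniq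
    (λ F∈X → colour-descent<k stable (Equivalence.to (X⇔Des _) F∈X))
    (Γ-colour-injective X X∈Γ _ _)

  balanced : Balanced (V M _◁_) (Γ M _◁_)
  balanced = record
    { dim+1         = k
    ; isDim+1       = (oddFlags , oddFlags∈Γ , length-applyUpTo _ k) , Γ-length≤k
    ; colour        = colour
    ; colour<dim+1  = colour<k
    ; colour-proper = Γ-colour-injective
    }

theorem5p18 : (n : ℕ) (M : Matroid n) → Loopless M →
    (_◁_ : Rel (Fin n) 0ℓ) → IsStrictTotalOrder _≡_ _◁_ →
    Balanced (V M _◁_) (Γ M _◁_)
theorem5p18 n M loopless _◁_ ◁-sto = DescentComplex.balanced M loopless _◁_ ◁-sto
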